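{- For integers $c\geq 1$ and $n\geq 0$, let $\overline{a}_c(n)$ be defined by $$\sum_{n\geq 0}\overline{a}_c(n)q^n=\frac{(-q;q)_\infty\,(-q^2;q^2)_\infty^{c-1}}{(q;q)_\infty\,(q^2;q^2)_\infty^{c-1}},$$ where $(a;q)_\infty=\prod_{j\geq 0}(1-aq^j)$. Let $p\geq 3$ be prime, let $r$ be an integer with $1\leq r\leq p-1$ such that $r$ is a quadratic nonresidue modulo $p$, and let $k$ be a positive integer. Then for all $n\geq 0$, $\overline{a}_{kp-1}(pn+r)\equiv 0\pmod{p}$.
   Context: Combinatorially, $\overline{a}_c(n)$ counts generalized cubic overpartitions of $n$: overpartitions (the first occurrence of each part may be overlined) in which each even part may appear in $c$ colors. -}

module Defs where

open import Data.Nat using (ℕ; zero; suc; _+_; _*_; _∸_; _%_)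
open import Data.Nat.Divisibility using (_∣_)
open import Data.Nat.Primality using (Prime)
open import Data.Product using (∃; _×_)
open import Relation.Nullary using (¬_)
open import Relation.Binary.PropositionalEquality using (_≡_)

Series : Set
Series = ℕ → ℕ

one : Series
one zero    = 1
one (suc _) = 0

convAux : Series → Series → ℕ → ℕ → ℕ
convAux f g n zero    = f 0 * g n
convAux f g n (suc i) = f (suc i) * g (n ∸ suc i) + convAux f g n i

_⊛_ : Series → Series → Series
(f ⊛ g) n = convAux f g n n

-- 1 + q^j   (for j ≥ 1)
onePlus : ℕ → Series
onePlus j zero    = 1
onePlus j (suc m) with (suc m) Data.Nat.≟ j
... | Relation.Nullary.yes _ = 1
... | Relation.Nullary.no  _ = 0

-- 1/(1 - q^j) = Σ_m q^{jm}   (for j ≥ 1)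
geom : ℕ → Series
geom j m with m % suc (j ∸ 1)
... | zero  = 1
... | suc _ = 0

ratio : ℕ → Series
ratio j = onePlus j ⊛ geom j

pow : Series → ℕ → Series
pow f zero    = one
pow f (suc e) = f ⊛ pow f e

isEven : ℕ → Set
isEven j = 2 ∣ j

-- Factor of index j ≥ 1 in the product
--   (-q;q)∞ (-q²;q²)∞^{c-1} / ((q;q)∞ (q²;q²)∞^{c-1}):
-- (1+q^j)/(1-q^j), times ((1+q^j)/(1-q^j))^{c-1} when j is even.
factor : ℕ → ℕ → Series
factor c j with Data.Nat.Divisibility._∣?_ 2 j
... | Relation.Nullary.yes _ = ratio j ⊛ pow (ratio j) (c ∸ 1)
... | Relation.Nullary.no  _ = ratio j

prodUpTo : ℕ → ℕ → Series
prodUpTo c zero    = one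
prodUpTo c (suc N) = factor c (suc N) ⊛ prodUpTo c N

-- ā_c(n): coefficient of q^n. Factors with j > n are ≡ 1 mod q^{n+1},
-- so the finite product over j ≤ n gives the exact coefficient.
abar : ℕ → ℕ → ℕ
abar c n = prodUpTo c n n

QNR : ℕ → ℕ → Set
QNR p r = ¬ ∃ λ x → (x * x) % suc (p ∸ 1) ≡ r % suc (p ∸ 1)

{-# OPTIONS --safe #-}
-- Put φ(q) = ∑ₛ q^(s²) over all integers s.  Gauss's product for φ, taken at x = −q, reads
-- φ(q) ∏ⱼ (1+xʲ)/(1−xʲ) = 1.  For odd j the j-th factor is the inverse of (1+qʲ)/(1−qʲ), for even j
-- it equals (1+qʲ)/(1−qʲ).  Hence the generating function of ā_{kp−1} is φ(q) H(q), where H is the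
-- product of the ((1+qʲ)/(1−qʲ))^(kp) over even j.  The derivation θ = q d/dq sends a (kp)-th power
-- to a multiple of p, so p ∣ m·H(m) for all m, and H has coefficients divisible by p at all exponents
-- prime to p.  The coefficient of φ H at pn + r is a sum of terms φ(s²) H(pn + r − s²), and
-- p ∤ pn + r − s² because r is a nonresidue.
module Submission where

open import Defs

open import Algebra.Bundles using (CommutativeRing)
open import Data.Integer as ℤ using (ℤ; +_)
import Data.Integer.Divisibility.Signed as ℤ∣
import Data.Integer.Properties as ℤ
open import Data.Integer.Tactic.RingSolver using (solve-∀)
open import Data.Nat using (ℕ; zero; suc; _∸_; _≤_; _<_; _≟_; s≤s; z≤n)
open import Data.Nat.Divisibility using (_∣_; _∣?_; divides; ∣-refl; ∣m∣n⇒∣m+n)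
open import Data.Nat.DivMod using (_%_; m<n⇒m%n≡m; [m+n]%n≡m%n; [m+kn]%n≡m%n)
open import Data.Nat.Primality using (Prime; euclidsLemma)
import Data.Nat as ℕ
import Data.Nat.Properties as ℕ
open import Data.Product using (∃; _,_; proj₁; proj₂)
open import Data.Sum using (_⊎_; inj₁; inj₂)
open import Level using (0ℓ; _⊔_)
open import Relation.Binary.PropositionalEquality as ≡ using (_≡_; _≢_; cong; cong₂)
open import Relation.Nullary using (¬_; Dec; yes; no; contradiction)

-- Parity of indices, and residues modulo p.

∣n⊎∣1+n : ∀ n → 2 ∣ n ⊎ 2 ∣ suc n
∣n⊎∣1+n zero    = inj₁ (divides 0 ≡.refl)
∣n⊎∣1+n (suc n) with ∣n⊎∣1+n n
... | inj₁ 2∣n   = inj₂ (∣m∣n⇒∣m+n ∣-refl 2∣n)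
... | inj₂ 2∣1+n = inj₁ 2∣1+n

2∤1+n⇒2∣n : ∀ {n} → ¬ 2 ∣ suc n → 2 ∣ n
2∤1+n⇒2∣n {n} 2∤1+n with ∣n⊎∣1+n n
... | inj₁ 2∣n   = 2∣n
... | inj₂ 2∣1+n = contradiction 2∣1+n 2∤1+n

factor-even : ∀ c {j} → 2 ∣ j → factor c j ≡ ratio j ⊛ pow (ratio j) (c ∸ 1)
factor-even c {j} 2∣j with 2 ∣? j
... | yes _  = ≡.refl
... | no 2∤j = contradiction 2∣j 2∤j

factor-odd : ∀ c {j} → ¬ 2 ∣ j → factor c j ≡ ratio j
factor-odd c {j} 2∤j with 2 ∣? j
... | yes 2∣j = contradiction 2∣j 2∤j
... | no _    = ≡.refl

-- If p divided j, reducing s² + j = pn + r modulo p would exhibit r as the square of s.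
QNR⇒p∤ : ∀ {p r} n s j → QNR p r → s ℕ.* s ℕ.+ j ≡ p ℕ.* n ℕ.+ r → 1 ≤ p → ¬ p ∣ j
QNR⇒p∤ {suc p} {r} n s j qnr s²+j≡pn+r _ (divides k j≡kp) = qnr (s , (begin
  (s ℕ.* s) % suc p                    ≡⟨ [m+kn]%n≡m%n (s ℕ.* s) k (suc p) ⟨
  (s ℕ.* s ℕ.+ k ℕ.* suc p) % suc p    ≡⟨ cong (λ t → (s ℕ.* s ℕ.+ t) % suc p) j≡kp ⟨
  (s ℕ.* s ℕ.+ j) % suc p              ≡⟨ cong (_% suc p) s²+j≡pn+r ⟩
  (suc p ℕ.* n ℕ.+ r) % suc p          ≡⟨ cong (_% suc p) (ℕ.+-comm (suc p ℕ.* n) r) ⟩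
  (r ℕ.+ suc p ℕ.* n) % suc p          ≡⟨ cong (λ t → (r ℕ.+ t) % suc p) (ℕ.*-comm (suc p) n) ⟩
  (r ℕ.+ n ℕ.* suc p) % suc p          ≡⟨ [m+kn]%n≡m%n r n (suc p) ⟩
  r % suc p                            ∎))
  where open ≡.≡-Reasoning

-- Identities valid in every commutative ring.

module RingLemmas {c ℓ} (R : CommutativeRing c ℓ) where
  open CommutativeRing R hiding (zero)
  open import Algebra.Properties.Semiring.Exp semiring using (_^_; ^-congˡ; ^-assocʳ)
  open import Algebra.Properties.CommutativeSemiring.Exp commutativeSemiring using (^-distrib-*)
  open import Algebra.Properties.Ring ring using (-‿distribˡ-*; -‿distribʳ-*; -‿involutive; +-cancelʳ)
  open import Algebra.Properties.Semiring.Mult semiring using (_×_; ×-congʳ; ×-assocˡ; ×-comm-*; ×-assoc-*)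
  open import Algebra.Properties.CommutativeMonoid.Mult +-commutativeMonoid using (×-distrib-+)
  open import Algebra.Solver.Ring.NaturalCoefficients.Default commutativeSemiring using (solve; _:+_; _:*_; con; _:=_)
  open import Relation.Binary.Reasoning.Setoid setoid

  1-x+x≈1 : ∀ x → (1# - x) + x ≈ 1#
  1-x+x≈1 x = trans (+-assoc 1# (- x) x) (trans (+-congˡ (-‿inverseˡ x)) (+-identityʳ 1#))

  -- Shanks' finite form of Gauss's theorem.  P n = ∏_{1≤j≤n} (1+xʲ)/(1−xʲ), with v j the inverse of
  -- 1 − x^(j+1); δ s = 2(−1)ˢ; S n = ∑_{|s|≤n} (−1)ˢ x^(s²); and
  -- W y n = 1 + ∑_{1≤s≤n} δ s P(s−1) yˢ/(1−xˢ), which at y = x^(n+1) equals S n · P n.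
  module GaussSum (x : Carrier) (v : ℕ → Carrier)
                  (v-inverse : ∀ j → v j * (1# - x ^ suc j) ≈ 1#) where

    δ : ℕ → Carrier
    δ zero    = 1# + 1#
    δ (suc s) = - δ s

    P : ℕ → Carrier
    P zero    = 1#
    P (suc s) = P s * ((1# + x ^ suc s) * v s)

    S : ℕ → Carrier
    S zero    = 1#
    S (suc n) = S n + δ (suc n) * (x ^ suc n) ^ suc n

    c′ : ℕ → Carrier
    c′ s = δ (suc s) * P s * v s

    W : Carrier → ℕ → Carrier
    W y zero    = 1#
    W y (suc s) = W y s + c′ s * y ^ suc s

    -- Since `v s` inverts 1 - z for z = x^(s+1), c′ s (1 - z) = δ (s+1) P s = -δ s P s. Both sides
    -- are written without subtraction, to suit the semiring solver.
    c′-relation : ∀ s → c′ s + δ s * P s ≈ c′ s * x ^ suc s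
    c′-relation s = begin
      c′ s + d                                  ≈⟨ +-congʳ (*-identityʳ (c′ s)) ⟨
      c′ s * 1# + d                             ≈⟨ +-congʳ (*-congˡ (1-x+x≈1 z)) ⟨
      c′ s * ((1# - z) + z) + d
        ≈⟨ solve 6 (λ e p w m u f → (e :* p :* w) :* (m :+ u) :+ f :* p
             := ((e :* (w :* m) :+ f) :* p) :+ (e :* p :* w) :* u)
           refl (δ (suc s)) (P s) (v s) (1# - z) z (δ s) ⟩
      (δ (suc s) * (v s * (1# - z)) + δ s) * P s + c′ s * z
        ≈⟨ +-congʳ (*-congʳ (+-congʳ (trans (*-congˡ (v-inverse s)) (*-identityʳ _)))) ⟩
      (- δ s + δ s) * P s + c′ s * z            ≈⟨ +-congʳ (trans (*-congʳ (-‿inverseˡ (δ s))) (zeroˡ (P s))) ⟩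
      0# + c′ s * z                             ≈⟨ +-identityˡ _ ⟩
      c′ s * z                                  ∎
      where
      z d : Carrier
      z = x ^ suc s
      d = δ s * P s

    -- The sum of the differences telescopes, since c′ s (1 − z) = −δ s P s and
    -- c′ s (1 + z) = δ (s+1) P (s+1) for z = x^(s+1); the last term of the telescope is kept on the left.
    W-functional : ∀ y s →
      (1# - y) * W (x * y) s + δ s * P s * y ^ suc s ≈ (1# + y) * W y s
    W-functional y zero = begin
      (1# - y) * 1# + (1# + 1#) * 1# * (y * 1#)
        ≈⟨ solve 2 (λ m y → m :* con 1 :+ con 2 :* con 1 :* (y :* con 1) := (m :+ y) :+ y) refl (1# - y) y ⟩
      ((1# - y) + y) + y                          ≈⟨ +-congʳ (1-x+x≈1 y) ⟩
      1# + y                                      ≈⟨ *-identityʳ _ ⟨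
      (1# + y) * 1#                               ∎
    W-functional y (suc s) = begin
      m * (W (x * y) s + c′ s * (x * y) ^ suc s) + δ (suc s) * P (suc s) * (y * Y)
        ≈⟨ +-congʳ (*-congˡ (+-congˡ (*-congˡ (^-distrib-* x y (suc s))))) ⟩
      m * (w + c′ s * (z * Y)) + δ (suc s) * P (suc s) * (y * Y)
        ≈⟨ solve 8 (λ m w z Y e p v y → m :* (w :+ e :* p :* v :* (z :* Y)) :+ e :* (p :* ((con 1 :+ z) :* v)) :* (y :* Y)
                := m :* w :+ (m :+ y) :* (e :* p :* v :* z) :* Y :+ y :* (e :* p :* v) :* Y)
             refl m w z Y (δ (suc s)) (P s) (v s) y ⟩
      m * w + (m + y) * (c′ s * z) * Y + y * c′ s * Y
        ≈⟨ +-congʳ (+-congˡ (*-congʳ (trans (*-congʳ (1-x+x≈1 y)) (trans (*-identityˡ _) (sym (c′-relation s)))))) ⟩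
      m * w + (c′ s + δ s * P s) * Y + y * c′ s * Y
        ≈⟨ solve 6 (λ a k d Y y w′ → a :+ (k :+ d) :* Y :+ y :* k :* Y
             := (a :+ d :* Y) :+ (con 1 :+ y) :* (k :* Y)) refl (m * w) (c′ s) (δ s * P s) Y y w ⟩
      (m * w + δ s * P s * Y) + (1# + y) * (c′ s * Y)
        ≈⟨ +-congʳ (W-functional y s) ⟩
      (1# + y) * W y s + (1# + y) * (c′ s * Y)
        ≈⟨ distribˡ _ _ _ ⟨
      (1# + y) * (W y s + c′ s * Y) ∎
      where
      m w z Y : Carrier
      m = 1# - y
      w = W (x * y) s
      z = x ^ suc s
      Y = y ^ suc s

    -- Induction on n. With y = x^(n+1), the functional equation trades `W (x * y) n` for `W y n`,
    -- where the hypothesis applies; dividing by 1 - y produces the factor (1 + y) `v n` that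
    -- extends `P n` to `P (suc n)`.
    W≈S*P : ∀ n → W (x ^ suc n) n ≈ S n * P n
    W≈S*P zero    = sym (*-identityˡ 1#)
    W≈S*P (suc n) = begin
      W (x * y) n + c′ n * (x * y) ^ suc n
        ≈⟨ +-cong (trans (sym (*-identityˡ w)) (*-congʳ (sym (v-inverse n)))) (*-congˡ (^-distrib-* x y (suc n))) ⟩
      (u * m) * w + c′ n * (y * Y)
        ≈⟨ +-identityʳ _ ⟨
      (u * m) * w + c′ n * (y * Y) + 0#
        -- The inserted zero is split in two: the part with `δ n` completes the left side of
        -- `W-functional`, and the part with -δ n = δ (n+1) joins the last summand of `W` to form
        -- the factor 1 + y.
        ≈⟨ +-congˡ (trans (*-congʳ (-‿inverseˡ (δ n))) (zeroˡ _)) ⟨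
      (u * m) * w + c′ n * (y * Y) + (- δ n + δ n) * (P n * u * Y)
        ≈⟨ solve 8 (λ u m w e p y Y f → (u :* m) :* w :+ e :* p :* u :* (y :* Y) :+ (e :+ f) :* (p :* u :* Y)
             := u :* (m :* w :+ f :* p :* Y) :+ e :* Y :* (p :* ((con 1 :+ y) :* u)))
             refl u m w (δ (suc n)) (P n) y Y (δ n) ⟩
      u * (m * w + δ n * P n * Y) + δ (suc n) * Y * (P n * ((1# + y) * u))
        ≈⟨ +-congʳ (*-congˡ (trans (W-functional y n) (*-congˡ (W≈S*P n)))) ⟩
      u * ((1# + y) * (S n * P n)) + δ (suc n) * Y * (P n * ((1# + y) * u))
        ≈⟨ solve 5 (λ u y s p t → u :* ((con 1 :+ y) :* (s :* p)) :+ t :* (p :* ((con 1 :+ y) :* u))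
             := (s :+ t) :* (p :* ((con 1 :+ y) :* u)))
             refl u y (S n) (P n) (δ (suc n) * Y) ⟩
      S (suc n) * P (suc n) ∎
      where
      y u m w Y : Carrier
      y = x ^ suc n
      u = v n
      m = 1# - y
      w = W (x * y) n
      Y = y ^ suc n

    W≈1+y* : ∀ y s → ∃ λ e → W y s ≈ 1# + y * e
    W≈1+y* y zero    = 0# , sym (trans (+-congˡ (zeroʳ y)) (+-identityʳ 1#))
    W≈1+y* y (suc s) with e , W≈ ← W≈1+y* y s = e + c′ s * y ^ s , (begin
      W y s + c′ s * (y * y ^ s)         ≈⟨ +-congʳ W≈ ⟩
      1# + y * e + c′ s * (y * y ^ s)
        ≈⟨ solve 4 (λ y e k Y → con 1 :+ y :* e :+ k :* (y :* Y) := con 1 :+ y :* (e :+ k :* Y)) refl y e (c′ s) (y ^ s) ⟩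
      1# + y * (e + c′ s * y ^ s)        ∎)

    -- Gauss's identity in truncated form: every summand of `W` after the leading 1 carries a
    -- positive power of y = x^(n+1), so the error starts beyond degree n.
    S*P≈1+x^* : ∀ n → ∃ λ e → S n * P n ≈ 1# + x ^ suc n * e
    S*P≈1+x^* n with e , W≈ ← W≈1+y* (x ^ suc n) n = e , trans (sym (W≈S*P n)) W≈

  -- Powers of -x and inverses of 1 - y and 1 + y.

  -x*-x≈x*x : ∀ x → - x * - x ≈ x * x
  -x*-x≈x*x x = trans (sym (-‿distribˡ-* x (- x)))
    (trans (-‿cong (sym (-‿distribʳ-* x x))) (-‿involutive (x * x)))

  [-x]^even : ∀ x {n} → 2 ∣ n → (- x) ^ n ≈ x ^ n
  [-x]^even x (divides q ≡.refl) = begin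
    (- x) ^ (q ℕ.* 2)  ≡⟨ cong ((- x) ^_) (ℕ.*-comm q 2) ⟩
    (- x) ^ (2 ℕ.* q)  ≈⟨ ^-assocʳ (- x) 2 q ⟨
    ((- x) ^ 2) ^ q    ≈⟨ ^-congˡ q (*-congˡ (*-identityʳ (- x))) ⟩
    (- x * - x) ^ q    ≈⟨ ^-congˡ q (-x*-x≈x*x x) ⟩
    (x * x) ^ q        ≈⟨ ^-congˡ q (*-congˡ (*-identityʳ x)) ⟨
    (x ^ 2) ^ q        ≈⟨ ^-assocʳ x 2 q ⟩
    x ^ (2 ℕ.* q)      ≡⟨ cong (x ^_) (ℕ.*-comm 2 q) ⟩
    x ^ (q ℕ.* 2)      ∎

  [-x]^1+even : ∀ x {n} → 2 ∣ n → (- x) ^ suc n ≈ - (x ^ suc n)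
  [-x]^1+even x 2∣n = trans (*-congˡ ([-x]^even x 2∣n)) (sym (-‿distribˡ-* x _))

  geometric-inverse : ∀ {y g} → g ≈ 1# + y * g → g * (1# - y) ≈ 1#
  geometric-inverse {y} {g} g≈ = +-cancelʳ (y * g) _ _ (begin
    g * (1# - y) + y * g    ≈⟨ solve 3 (λ g m y → g :* m :+ y :* g := (m :+ y) :* g) refl g (1# - y) y ⟩
    ((1# - y) + y) * g      ≈⟨ trans (*-congʳ (1-x+x≈1 y)) (*-identityˡ g) ⟩
    g                       ≈⟨ g≈ ⟩
    1# + y * g              ∎)

  -- Here `g` stands for 1/(1 - y²), so (1 - y) g is the inverse of 1 + y.
  geometric-inverse-square : ∀ {y g} → g ≈ 1# + y * y * g → (1# - y) * g * (1# + y) ≈ 1#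
  geometric-inverse-square {y} {g} g≈ = +-cancelʳ (y * y * g) _ _ (begin
    m * g * (1# + y) + y * y * g
      ≈⟨ solve 3 (λ m g y → m :* g :* (con 1 :+ y) :+ y :* y :* g := (m :+ (m :+ y) :* y) :* g) refl m g y ⟩
    (m + (m + y) * y) * g
      ≈⟨ *-congʳ (trans (+-congˡ (trans (*-congʳ (1-x+x≈1 y)) (*-identityˡ y))) (1-x+x≈1 y)) ⟩
    1# * g      ≈⟨ *-identityˡ g ⟩
    g           ≈⟨ g≈ ⟩
    1# + y * y * g ∎)
    where
    m : Carrier
    m = 1# - y

  x*z≈y∧u*z≈1⇒x≈y*u : ∀ {x y z u} → x * z ≈ y → u * z ≈ 1# → x ≈ y * u
  x*z≈y∧u*z≈1⇒x≈y*u {x} {y} {z} {u} xz≈y uz≈1 = begin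
    x            ≈⟨ *-identityʳ x ⟨
    x * 1#       ≈⟨ *-congˡ uz≈1 ⟨
    x * (u * z)  ≈⟨ solve 3 (λ x u z → x :* (u :* z) := x :* z :* u) refl x u z ⟩
    x * z * u    ≈⟨ *-congʳ xz≈y ⟩
    y * u        ∎

  *-interchange : ∀ a b c d → (a * b) * (c * d) ≈ (a * d) * (b * c)
  *-interchange = solve 4 (λ a b c d → (a :* b) :* (c :* d) := (a :* d) :* (b :* c)) refl

  -- Derivations and elements whose derivative is a multiple of p.

  module Derivation (θ : Carrier → Carrier) (θ-cong : ∀ {f g} → f ≈ g → θ f ≈ θ g)
                    (θ-* : ∀ f g → θ (f * g) ≈ θ f * g + f * θ g) (θ-1 : θ 1# ≈ 0#) where

    -- For θ = q d/dq: modulo p, f is constant in the sense of differential algebra.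
    record ConstantMod (p : ℕ) (f : Carrier) : Set (c ⊔ ℓ) where
      constructor _,_
      field
        quotient : Carrier
        θ≈p×     : θ f ≈ p × quotient

    constant-≈ : ∀ {p f g} → f ≈ g → ConstantMod p f → ConstantMod p g
    constant-≈ f≈g (a , θf≈) = a , trans (θ-cong (sym f≈g)) θf≈

    constant-1 : ∀ p → ConstantMod p 1#
    constant-1 p = 0# , trans θ-1 (trans (sym (zeroˡ (p × 0#))) (trans (×-comm-* p 0# 0#) (×-congʳ p (zeroˡ 0#))))

    constant-* : ∀ {p f g} → ConstantMod p f → ConstantMod p g → ConstantMod p (f * g)
    constant-* {p} {f} {g} (a , θf≈) (b , θg≈) = a * g + f * b , (begin
      θ (f * g)                    ≈⟨ θ-* f g ⟩
      θ f * g + f * θ g            ≈⟨ +-cong (*-congʳ θf≈) (*-congˡ θg≈) ⟩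
      (p × a) * g + f * (p × b)    ≈⟨ +-cong (×-assoc-* p a g) (×-comm-* p f b) ⟩
      p × (a * g) + p × (f * b)    ≈⟨ ×-distrib-+ (a * g) (f * b) p ⟨
      p × (a * g + f * b)          ∎)

    θ-^ : ∀ f n → θ (f ^ suc n) ≈ suc n × (f ^ n * θ f)
    θ-^ f zero    = begin
      θ (f * 1#)             ≈⟨ θ-cong (*-identityʳ f) ⟩
      θ f                    ≈⟨ *-identityˡ _ ⟨
      1# * θ f               ≈⟨ +-identityʳ _ ⟨
      1# * θ f + 0#          ∎
    θ-^ f (suc n) = begin
      θ (f * f ^ suc n)                             ≈⟨ θ-* f (f ^ suc n) ⟩
      θ f * f ^ suc n + f * θ (f ^ suc n)           ≈⟨ +-cong (*-comm _ _) (*-congˡ (θ-^ f n)) ⟩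
      f ^ suc n * θ f + f * (suc n × (f ^ n * θ f)) ≈⟨ +-congˡ (×-comm-* (suc n) f _) ⟩
      f ^ suc n * θ f + suc n × (f * (f ^ n * θ f)) ≈⟨ +-congˡ (×-congʳ (suc n) (sym (*-assoc f _ _))) ⟩
      f ^ suc n * θ f + suc n × (f ^ suc n * θ f)   ∎

    -- The power rule brings down the exponent n + 1, which already contains p.
    constant-^ : ∀ {p n} f → p ∣ suc n → ConstantMod p (f ^ suc n)
    constant-^ {p} {n} f (divides k 1+n≡kp) = k × (f ^ n * θ f) , (begin
      θ (f ^ suc n)             ≈⟨ θ-^ f n ⟩
      suc n × (f ^ n * θ f)     ≡⟨ cong (_× (f ^ n * θ f)) (≡.trans 1+n≡kp (ℕ.*-comm k p)) ⟩
      (p ℕ.* k) × (f ^ n * θ f) ≈⟨ ×-assocˡ _ p k ⟨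
      p × (k × (f ^ n * θ f))   ∎)

-- The ring of formal power series over ℤ.

infix 4 _≋_
infixl 6 _⊕_
infixl 7 _∗_

ℤ⟦q⟧ : Set
ℤ⟦q⟧ = ℕ → ℤ

-- Wrapping pointwise equality in a record lets Agda infer the two series from a proof.
record _≋_ (f g : ℤ⟦q⟧) : Set where
  constructor pointwise
  field at : ∀ n → f n ≡ g n
open _≋_

tail : ∀ {A : Set} → (ℕ → A) → (ℕ → A)
tail f n = f (suc n)

_⊕_ : ℤ⟦q⟧ → ℤ⟦q⟧ → ℤ⟦q⟧
(f ⊕ g) n = f n ℤ.+ g n

⊖_ : ℤ⟦q⟧ → ℤ⟦q⟧
(⊖ f) n = ℤ.- f n

𝟘 : ℤ⟦q⟧
𝟘 _ = + 0

𝟙 : ℤ⟦q⟧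
𝟙 zero    = + 1
𝟙 (suc _) = + 0

-- Recursion through the tail of the left factor avoids truncated subtraction and lets the ring laws
-- go by induction on the exponent.
_∗_ : ℤ⟦q⟧ → ℤ⟦q⟧ → ℤ⟦q⟧
(f ∗ g) zero    = f 0 ℤ.* g 0
(f ∗ g) (suc n) = f 0 ℤ.* g (suc n) ℤ.+ (tail f ∗ g) n

∗-cong : ∀ {f f′ g g′} → f ≋ f′ → g ≋ g′ → f ∗ g ≋ f′ ∗ g′
∗-cong f≋ g≋ = pointwise (go f≋ g≋)
  where
  go : ∀ {f f′ g g′} → f ≋ f′ → g ≋ g′ → ∀ n → (f ∗ g) n ≡ (f′ ∗ g′) n
  go f≋ g≋ zero    = cong₂ ℤ._*_ (at f≋ 0) (at g≋ 0)
  go f≋ g≋ (suc n) = cong₂ ℤ._+_ (cong₂ ℤ._*_ (at f≋ 0) (at g≋ (suc n)))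
                                 (go (pointwise (λ m → at f≋ (suc m))) g≋ n)

-- The mirror image of the defining recursion, peeling the right factor instead; commutativity
-- follows by comparing the two.
∗-sucʳ : ∀ f g n → (f ∗ g) (suc n) ≡ f (suc n) ℤ.* g 0 ℤ.+ (f ∗ tail g) n
∗-sucʳ f g zero    = ℤ.+-comm (f 0 ℤ.* g 1) (f 1 ℤ.* g 0)
∗-sucʳ f g (suc n) = ≡.trans (cong (λ t → f 0 ℤ.* g (suc (suc n)) ℤ.+ t) (∗-sucʳ (tail f) g n))
  (swap (f 0 ℤ.* g (suc (suc n))) (f (suc (suc n)) ℤ.* g 0) ((tail f ∗ tail g) n))
  where
  swap : ∀ a b c → a ℤ.+ (b ℤ.+ c) ≡ b ℤ.+ (a ℤ.+ c)
  swap = solve-∀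

∗-comm : ∀ f g n → (f ∗ g) n ≡ (g ∗ f) n
∗-comm f g zero    = ℤ.*-comm (f 0) (g 0)
∗-comm f g (suc n) = ≡.trans (cong₂ ℤ._+_ (ℤ.*-comm (f 0) (g (suc n))) (∗-comm (tail f) g n))
                             (≡.sym (∗-sucʳ g f n))

∗-distribʳ : ∀ h f g n → ((f ⊕ g) ∗ h) n ≡ (f ∗ h ⊕ g ∗ h) n
∗-distribʳ h f g zero    = ℤ.*-distribʳ-+ (h 0) (f 0) (g 0)
∗-distribʳ h f g (suc n) = ≡.trans (cong (λ t → (f 0 ℤ.+ g 0) ℤ.* h (suc n) ℤ.+ t)
                                      (∗-distribʳ h (tail f) (tail g) n))
  (rearrange (f 0) (g 0) (h (suc n)) ((tail f ∗ h) n) ((tail g ∗ h) n))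
  where
  rearrange : ∀ a b x u v → (a ℤ.+ b) ℤ.* x ℤ.+ (u ℤ.+ v) ≡ (a ℤ.* x ℤ.+ u) ℤ.+ (b ℤ.* x ℤ.+ v)
  rearrange = solve-∀

∗-scale : ∀ a f g n → ((λ m → a ℤ.* f m) ∗ g) n ≡ a ℤ.* (f ∗ g) n
∗-scale a f g zero    = ℤ.*-assoc a (f 0) (g 0)
∗-scale a f g (suc n) = ≡.trans (cong (λ t → a ℤ.* f 0 ℤ.* g (suc n) ℤ.+ t) (∗-scale a (tail f) g n))
  (rearrange a (f 0) (g (suc n)) ((tail f ∗ g) n))
  where
  rearrange : ∀ a x y u → a ℤ.* x ℤ.* y ℤ.+ a ℤ.* u ≡ a ℤ.* (x ℤ.* y ℤ.+ u)
  rearrange = solve-∀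

∗-assoc : ∀ f g h n → ((f ∗ g) ∗ h) n ≡ (f ∗ (g ∗ h)) n
∗-assoc f g h zero    = ℤ.*-assoc (f 0) (g 0) (h 0)
∗-assoc f g h (suc n) = begin
  -- By definition the tail of f ∗ g is f 0 · tail g plus tail f ∗ g.
  f 0 ℤ.* g 0 ℤ.* h (suc n) ℤ.+ (((λ m → f 0 ℤ.* g (suc m)) ⊕ (tail f ∗ g)) ∗ h) n
    ≡⟨ cong (λ t → f 0 ℤ.* g 0 ℤ.* h (suc n) ℤ.+ t) (∗-distribʳ h _ _ n) ⟩
  f 0 ℤ.* g 0 ℤ.* h (suc n) ℤ.+ (((λ m → f 0 ℤ.* g (suc m)) ∗ h) n ℤ.+ ((tail f ∗ g) ∗ h) n)
    ≡⟨ cong (λ t → f 0 ℤ.* g 0 ℤ.* h (suc n) ℤ.+ t)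
            (cong₂ ℤ._+_ (∗-scale (f 0) (tail g) h n) (∗-assoc (tail f) g h n)) ⟩
  f 0 ℤ.* g 0 ℤ.* h (suc n) ℤ.+ (f 0 ℤ.* (tail g ∗ h) n ℤ.+ (tail f ∗ (g ∗ h)) n)
    ≡⟨ rearrange (f 0) (g 0) (h (suc n)) ((tail g ∗ h) n) ((tail f ∗ (g ∗ h)) n) ⟩
  f 0 ℤ.* (g 0 ℤ.* h (suc n) ℤ.+ (tail g ∗ h) n) ℤ.+ (tail f ∗ (g ∗ h)) n ∎
  where
  open ≡.≡-Reasoning
  rearrange : ∀ a b c d e → a ℤ.* b ℤ.* c ℤ.+ (a ℤ.* d ℤ.+ e) ≡ a ℤ.* (b ℤ.* c ℤ.+ d) ℤ.+ e
  rearrange = solve-∀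

∗-zeroˡ : ∀ {f} g n → (∀ m → f m ≡ + 0) → (f ∗ g) n ≡ + 0
∗-zeroˡ g zero    f≡0 rewrite f≡0 0 = ≡.refl
∗-zeroˡ g (suc n) f≡0 rewrite f≡0 0 = ≡.trans (ℤ.+-identityˡ _) (∗-zeroˡ g n (λ m → f≡0 (suc m)))

∗-identityˡ : ∀ f n → (𝟙 ∗ f) n ≡ f n
∗-identityˡ f zero    = ℤ.*-identityˡ (f 0)
∗-identityˡ f (suc n) = ≡.trans (cong₂ ℤ._+_ (ℤ.*-identityˡ (f (suc n))) (∗-zeroˡ f n (λ _ → ≡.refl)))
                                (ℤ.+-identityʳ _)

powerSeriesRing : CommutativeRing 0ℓ 0ℓ
powerSeriesRing = record
  { Carrier = ℤ⟦q⟧ ; _≈_ = _≋_ ; _+_ = _⊕_ ; _*_ = _∗_ ; -_ = ⊖_ ; 0# = 𝟘 ; 1# = 𝟙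
  ; isCommutativeRing = record
    { isRing = record
      { +-isAbelianGroup = record
        { isGroup = record
          { isMonoid = record
            { isSemigroup = record
              { isMagma = record
                { isEquivalence = record
                  { refl  = pointwise (λ _ → ≡.refl)
                  ; sym   = λ f≋g → pointwise (λ n → ≡.sym (at f≋g n))
                  ; trans = λ f≋g g≋h → pointwise (λ n → ≡.trans (at f≋g n) (at g≋h n))
                  }
                ; ∙-cong = λ f≋ g≋ → pointwise (λ n → cong₂ ℤ._+_ (at f≋ n) (at g≋ n))
                }
              ; assoc = λ f g h → pointwise (λ n → ℤ.+-assoc (f n) (g n) (h n))
              }
            ; identity = (λ f → pointwise (λ n → ℤ.+-identityˡ (f n)))
                       , (λ f → pointwise (λ n → ℤ.+-identityʳ (f n)))
            }
          ; inverse = (λ f → pointwise (λ n → ℤ.+-inverseˡ (f n)))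
                    , (λ f → pointwise (λ n → ℤ.+-inverseʳ (f n)))
          ; ⁻¹-cong = λ f≋ → pointwise (λ n → cong ℤ.-_ (at f≋ n))
          }
        ; comm = λ f g → pointwise (λ n → ℤ.+-comm (f n) (g n))
        }
      ; *-cong     = ∗-cong
      ; *-assoc    = λ f g h → pointwise (∗-assoc f g h)
      ; *-identity = (λ f → pointwise (∗-identityˡ f))
                   , (λ f → pointwise (λ n → ≡.trans (∗-comm f 𝟙 n) (∗-identityˡ f n)))
      ; distrib    = (λ h f g → pointwise (λ n → ≡.trans (∗-comm h (f ⊕ g) n)
                       (≡.trans (∗-distribʳ h f g n) (cong₂ ℤ._+_ (∗-comm f h n) (∗-comm g h n)))))
                   , (λ h f g → pointwise (∗-distribʳ h f g))
      }
    ; *-comm = λ f g → pointwise (∗-comm f g)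
    }
  }

∣-coefficient-∗ : ∀ {d} f g n → (∀ i j → i ℕ.+ j ≡ n → d ℤ∣.∣ f i ℤ.* g j) → d ℤ∣.∣ (f ∗ g) n
∣-coefficient-∗ f g zero    d∣ = d∣ 0 0 ≡.refl
∣-coefficient-∗ f g (suc n) d∣ = ℤ∣.∣m∣n⇒∣m+n (d∣ 0 (suc n) ≡.refl)
  (∣-coefficient-∗ (tail f) g n (λ i j i+j≡n → d∣ (suc i) j (cong suc i+j≡n)))

module GeneratingFunctions where
  open CommutativeRing powerSeriesRing hiding (zero)
  open import Algebra.Properties.Ring ring using (-‿distribˡ-*; -‿involutive)
  open import Algebra.Properties.Semiring.Exp semiring using (_^_; ^-homo-*; ^-assocʳ)
  open import Algebra.Properties.Semiring.Mult semiring using (_×_)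
  open import Relation.Binary.Reasoning.Setoid setoid
  open RingLemmas powerSeriesRing

  -- The derivation q d/dq on power series.

  θ : ℤ⟦q⟧ → ℤ⟦q⟧
  θ f n = + n ℤ.* f n

  -- Induction on the exponent. As tail (θ f) = tail f + θ (tail f), one extra tail f ∗ g is needed,
  -- and it is the difference between the multiplier n + 1 and the multiplier n of the induction
  -- hypothesis.
  θ-∗ : ∀ f g n → θ (f ∗ g) n ≡ (θ f ∗ g ⊕ f ∗ θ g) n
  θ-∗ f g zero    = rearrange (f 0) (g 0)
    where
    rearrange : ∀ a b → + 0 ℤ.* (a ℤ.* b) ≡ + 0 ℤ.* a ℤ.* b ℤ.+ a ℤ.* (+ 0 ℤ.* b)
    rearrange = solve-∀
  θ-∗ f g (suc n) = ≡.trans (rearrange₁ (+ n) (f 0) (g (suc n)) ((tail f ∗ g) n))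
    (≡.trans (cong (λ t → f 0 ℤ.* ((+ 1 ℤ.+ + n) ℤ.* g (suc n)) ℤ.+ (tail f ∗ g) n ℤ.+ t) (θ-∗ (tail f) g n))
    (≡.trans (rearrange₂ (f 0) (g (suc n)) (f 0 ℤ.* θ g (suc n)) ((tail f ∗ g) n) ((θ (tail f) ∗ g) n) ((tail f ∗ θ g) n))
             (cong (λ t → (+ 0 ℤ.* f 0 ℤ.* g (suc n) ℤ.+ t) ℤ.+ (f 0 ℤ.* θ g (suc n) ℤ.+ (tail f ∗ θ g) n))
                   (≡.sym tail-θ))))
    where
    rearrange₁ : ∀ k a b c → (+ 1 ℤ.+ k) ℤ.* (a ℤ.* b ℤ.+ c) ≡ a ℤ.* ((+ 1 ℤ.+ k) ℤ.* b) ℤ.+ c ℤ.+ k ℤ.* c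
    rearrange₁ = solve-∀
    rearrange₂ : ∀ a b x c u w → x ℤ.+ c ℤ.+ (u ℤ.+ w) ≡ (+ 0 ℤ.* a ℤ.* b ℤ.+ (c ℤ.+ u)) ℤ.+ (x ℤ.+ w)
    rearrange₂ = solve-∀
    suc-* : ∀ k a → (+ 1 ℤ.+ k) ℤ.* a ≡ a ℤ.+ k ℤ.* a
    suc-* = solve-∀
    tail-θ : (tail (θ f) ∗ g) n ≡ (tail f ∗ g) n ℤ.+ (θ (tail f) ∗ g) n
    tail-θ = ≡.trans (at (∗-cong {tail (θ f)} {tail f ⊕ θ (tail f)} (pointwise (λ m → suc-* (+ m) (f (suc m)))) (refl {g})) n)
                     (∗-distribʳ g (tail f) (θ (tail f)) n)

  θ-𝟙 : ∀ n → θ 𝟙 n ≡ + 0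
  θ-𝟙 zero    = ≡.refl
  θ-𝟙 (suc n) = ℤ.*-zeroʳ (+ suc n)

  open Derivation θ (λ f≋g → pointwise (λ n → cong (+ n ℤ.*_) (at f≋g n)))
                    (λ f g → pointwise (θ-∗ f g)) (pointwise θ-𝟙)

  ×-coefficient : ∀ m f n → (m × f) n ≡ + m ℤ.* f n
  ×-coefficient zero    f n = ≡.refl
  ×-coefficient (suc m) f n = ≡.trans (cong (λ t → f n ℤ.+ t) (×-coefficient m f n)) (≡.sym (ℤ.suc-* (+ m) (f n)))

  -- The n-th coefficient of θ f is n · f n, so p divides this product, and Euclid's lemma removes
  -- the factor n.
  constantMod⇒∣coefficient : ∀ {p f} → Prime p → ConstantMod p f → ∀ {n} → ¬ p ∣ n → + p ℤ∣.∣ f n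
  constantMod⇒∣coefficient {p} {f} p-prime (g , θf≋p×g) {n} p∤n
    with euclidsLemma n ℤ.∣ f n ∣ p-prime (≡.subst (p ∣_) (ℤ.abs-* (+ n) (f n)) (ℤ∣.∣⇒∣ᵤ p∣n*fn))
    where
    p∣n*fn : + p ℤ∣.∣ + n ℤ.* f n
    p∣n*fn = ℤ∣.divides (g n) (≡.trans (at θf≋p×g n) (≡.trans (×-coefficient p g n) (ℤ.*-comm (+ p) (g n))))
  ... | inj₁ p∣n  = contradiction p∣n p∤n
  ... | inj₂ p∣fn = ℤ∣.∣ᵤ⇒∣ p∣fn

  -- Transfer from series with natural coefficients.

  ι : Series → ℤ⟦q⟧
  ι f n = + f n

  -- `convAux` peels off the highest index and `∗` the lowest; isolating the term of index 0
  -- reconciles the two recursions.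
  convAux-sucˡ : ∀ f g m i → convAux f g (suc m) (suc i) ≡ f 0 ℕ.* g (suc m) ℕ.+ convAux (tail f) g m i
  convAux-sucˡ f g m zero    = ℕ.+-comm (f 1 ℕ.* g m) _
  convAux-sucˡ f g m (suc i) = ≡.trans (cong (λ t → a ℕ.+ t) (convAux-sucˡ f g m i))
    (≡.trans (≡.sym (ℕ.+-assoc a b c)) (≡.trans (cong (λ t → t ℕ.+ c) (ℕ.+-comm a b)) (ℕ.+-assoc b a c)))
    where
    a b c : ℕ
    a = f (suc (suc i)) ℕ.* g (m ∸ suc i)
    b = f 0 ℕ.* g (suc m)
    c = convAux (tail f) g m i

  ι-⊛ : ∀ f g → ι (f ⊛ g) ≋ ι f ∗ ι g
  ι-⊛ f g = pointwise (go f g)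
    where
    go : ∀ f g n → + (f ⊛ g) n ≡ (ι f ∗ ι g) n
    go f g zero    = ℤ.pos-* (f 0) (g 0)
    go f g (suc n) = ≡.trans (cong +_ (convAux-sucˡ f g n n))
      (≡.trans (ℤ.pos-+ (f 0 ℕ.* g (suc n)) ((tail f ⊛ g) n))
               (cong₂ ℤ._+_ (ℤ.pos-* (f 0) (g (suc n))) (go (tail f) g n)))

  ι-one : ι one ≋ 𝟙
  ι-one = pointwise λ { zero → ≡.refl ; (suc _) → ≡.refl }

  ι-pow : ∀ f e → ι (pow f e) ≋ ι f ^ e
  ι-pow f zero    = ι-one
  ι-pow f (suc e) = trans (ι-⊛ f (pow f e)) (*-congˡ (ι-pow f e))

  -- Powers of the indeterminate, and the substitution of -q.

  X : ℤ⟦q⟧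
  X 1 = + 1
  X _ = + 0

  X∗-suc : ∀ f n → (X ∗ f) (suc n) ≡ f n
  X∗-suc f n = ≡.trans (ℤ.+-identityˡ _)
    (≡.trans (at (∗-cong {tail X} {𝟙} (pointwise λ { zero → ≡.refl ; (suc _) → ≡.refl }) (refl {f})) n)
              (∗-identityˡ f n))

  X^∗-+ : ∀ j f n → (X ^ j ∗ f) (j ℕ.+ n) ≡ f n
  X^∗-+ zero    f n = ∗-identityˡ f n
  X^∗-+ (suc j) f n = ≡.trans (∗-assoc X (X ^ j) f (suc (j ℕ.+ n))) (≡.trans (X∗-suc (X ^ j ∗ f) (j ℕ.+ n)) (X^∗-+ j f n))

  X^∗-< : ∀ {j n} f → n < j → (X ^ j ∗ f) n ≡ + 0
  X^∗-< {suc j} {zero}  f n<j       = ∗-assoc X (X ^ j) f 0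
  X^∗-< {suc j} {suc n} f (s≤s n<j) = ≡.trans (∗-assoc X (X ^ j) f (suc n)) (≡.trans (X∗-suc (X ^ j ∗ f) n) (X^∗-< f n<j))

  X^-diagonal : ∀ n → (X ^ n) n ≡ + 1
  X^-diagonal zero    = ≡.refl
  X^-diagonal (suc n) = ≡.trans (X∗-suc (X ^ n) n) (X^-diagonal n)

  X^-off-diagonal : ∀ {j n} → n ≢ j → (X ^ j) n ≡ + 0
  X^-off-diagonal {zero}  {zero}  n≢j = contradiction ≡.refl n≢j
  X^-off-diagonal {zero}  {suc n} n≢j = ≡.refl
  X^-off-diagonal {suc j} {zero}  n≢j = ≡.refl
  X^-off-diagonal {suc j} {suc n} n≢j = ≡.trans (X∗-suc (X ^ j) n) (X^-off-diagonal λ n≡j → n≢j (cong suc n≡j))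

  x : ℤ⟦q⟧
  x = - X

  -- Only the vanishing of coefficients is to be carried over from X to x = -X, so the sign is left
  -- undetermined.
  x^∗≈±X^∗ : ∀ j f → x ^ j ∗ f ≈ X ^ j ∗ f ⊎ x ^ j ∗ f ≈ - (X ^ j ∗ f)
  x^∗≈±X^∗ zero    f = inj₁ refl
  x^∗≈±X^∗ (suc j) f with ∣n⊎∣1+n j
  ... | inj₁ 2∣j   = inj₂ (trans (*-congʳ ([-x]^1+even X 2∣j)) (sym (-‿distribˡ-* (X ^ suc j) f)))
  ... | inj₂ 2∣1+j = inj₁ (*-congʳ ([-x]^even X 2∣1+j))

  x^∗-≡0 : ∀ j f {n} → (X ^ j ∗ f) n ≡ + 0 → (x ^ j ∗ f) n ≡ + 0
  x^∗-≡0 j f {n} X^∗f≡0 with x^∗≈±X^∗ j f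
  ... | inj₁ ≈+ = ≡.trans (at ≈+ n) X^∗f≡0
  ... | inj₂ ≈- = ≡.trans (at ≈- n) (cong ℤ.-_ X^∗f≡0)

  -- The factors (1 + qʲ)/(1 - qʲ) and their values at -q.

  onePlus≈1+X^ : ∀ j → ι (onePlus (suc j)) ≈ 1# + X ^ suc j
  onePlus≈1+X^ j = pointwise go
    where
    go : ∀ n → + onePlus (suc j) n ≡ (1# + X ^ suc j) n
    go zero = ≡.refl
    go (suc m) with suc m ≟ suc j
    ... | yes ≡.refl = ≡.sym (≡.trans (ℤ.+-identityˡ _) (X^-diagonal (suc j)))
    ... | no m≢j     = ≡.sym (≡.trans (ℤ.+-identityˡ _) (X^-off-diagonal m≢j))

  geom-< : ∀ {j m} → suc m < suc j → geom (suc j) (suc m) ≡ 0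
  geom-< {j} {m} m<j rewrite m<n⇒m%n≡m m<j = ≡.refl

  geom-+ : ∀ j m → geom (suc j) (suc j ℕ.+ m) ≡ geom (suc j) m
  geom-+ j m rewrite ≡.trans (cong (_% suc j) (ℕ.+-comm (suc j) m)) ([m+n]%n≡m%n m (suc j)) = ≡.refl

  -- Below degree j + 1 the only nonzero coefficient is the constant 1, and from there on the
  -- coefficients repeat with period j + 1.
  geom≈1+X^*geom : ∀ j → ι (geom (suc j)) ≈ 1# + X ^ suc j * ι (geom (suc j))
  geom≈1+X^*geom j = pointwise go
    where
    G : ℤ⟦q⟧
    G = ι (geom (suc j))
    go : ∀ n → G n ≡ (1# + X ^ suc j * G) n
    go n with n ℕ.<? suc j
    go zero    | yes n<j = ≡.sym (cong (λ t → + 1 ℤ.+ t) (X^∗-< G n<j))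
    go (suc m) | yes n<j = ≡.trans (cong +_ (geom-< n<j)) (≡.sym (cong (λ t → + 0 ℤ.+ t) (X^∗-< G n<j)))
    go n       | no  n≮j with n ∸ suc j | ℕ.m+[n∸m]≡n (ℕ.≮⇒≥ n≮j)
    ... | m | ≡.refl = ≡.trans (cong +_ (geom-+ j m)) (≡.sym (≡.trans (ℤ.+-identityˡ _) (X^∗-+ (suc j) G m)))

  1-x^-invertible : ∀ j → ∃ λ v → v * (1# - x ^ suc j) ≈ 1#
  1-x^-invertible j with ∣n⊎∣1+n j
  ... | inj₂ 2∣1+j = ι (geom (suc j)) ,
    trans (*-congˡ {ι (geom (suc j))} (+-congˡ {1#} (-‿cong ([-x]^even X 2∣1+j)))) (geometric-inverse (geom≈1+X^*geom j))
  -- The exponent j + 1 is odd, so the series to invert is 1 + y with y = X^(j+1); the witness is (1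
  -- - y)/(1 - y²), whose denominator is a geometric series of step 2(j + 1).
  ... | inj₁ 2∣j   = (1# - y) * G , (begin
    (1# - y) * G * (1# - x ^ suc j)  ≈⟨ *-congˡ {(1# - y) * G} (+-congˡ {1#} (-‿cong ([-x]^1+even X 2∣j))) ⟩
    (1# - y) * G * (1# - - y)        ≈⟨ *-congˡ {(1# - y) * G} (+-congˡ {1#} (-‿involutive y)) ⟩
    (1# - y) * G * (1# + y)
      ≈⟨ geometric-inverse-square (trans (geom≈1+X^*geom _) (+-congˡ {1#} (*-congʳ (^-homo-* X (suc j) (suc j))))) ⟩
    1#                               ∎)
    where
    y G : ℤ⟦q⟧
    y = X ^ suc j
    G = ι (geom (suc j ℕ.+ suc j))

  v : ℕ → ℤ⟦q⟧
  v j = proj₁ (1-x^-invertible j)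

  v-inverse : ∀ j → v j * (1# - x ^ suc j) ≈ 1#
  v-inverse j = proj₂ (1-x^-invertible j)

  open GaussSum x v v-inverse

  ratio*[1-X^] : ∀ j → ι (ratio (suc j)) * (1# - X ^ suc j) ≈ 1# + X ^ suc j
  ratio*[1-X^] j = begin
    ι (ratio (suc j)) * (1# - y)                          ≈⟨ *-congʳ (ι-⊛ (onePlus (suc j)) (geom (suc j))) ⟩
    ι (onePlus (suc j)) * ι (geom (suc j)) * (1# - y)     ≈⟨ *-assoc (ι (onePlus (suc j))) (ι (geom (suc j))) (1# - y) ⟩
    ι (onePlus (suc j)) * (ι (geom (suc j)) * (1# - y))   ≈⟨ *-cong (onePlus≈1+X^ j) (geometric-inverse (geom≈1+X^*geom j)) ⟩
    (1# + y) * 1#                                         ≈⟨ *-identityʳ (1# + y) ⟩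
    1# + y                                                ∎
    where
    y : ℤ⟦q⟧
    y = X ^ suc j

  ratio≈-even : ∀ {j} → 2 ∣ suc j → ι (ratio (suc j)) ≈ (1# + x ^ suc j) * v j
  ratio≈-even {j} 2∣j = x*z≈y∧u*z≈1⇒x≈y*u (begin
    ι (ratio (suc j)) * (1# - x ^ suc j)  ≈⟨ *-congˡ {ι (ratio (suc j))} (+-congˡ {1#} (-‿cong ([-x]^even X 2∣j))) ⟩
    ι (ratio (suc j)) * (1# - X ^ suc j)  ≈⟨ ratio*[1-X^] j ⟩
    1# + X ^ suc j                        ≈⟨ +-congˡ {1#} ([-x]^even X 2∣j) ⟨
    1# + x ^ suc j                        ∎) (v-inverse j)

  -- The index j + 1 is odd, so passing from X to x = -X exchanges the numerator 1 + X^(j+1) with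
  -- the denominator 1 - X^(j+1).
  ratio-inverse-odd : ∀ {j} → 2 ∣ j → ι (ratio (suc j)) * ((1# + x ^ suc j) * v j) ≈ 1#
  ratio-inverse-odd {j} 2∣j = begin
    r * ((1# + x ^ suc j) * v j)  ≈⟨ *-assoc r (1# + x ^ suc j) (v j) ⟨
    r * (1# + x ^ suc j) * v j    ≈⟨ *-congʳ (*-congˡ {r} (+-congˡ {1#} ([-x]^1+even X 2∣j))) ⟩
    r * (1# - X ^ suc j) * v j    ≈⟨ *-congʳ (ratio*[1-X^] j) ⟩
    (1# + X ^ suc j) * v j        ≈⟨ *-congʳ (+-congˡ {1#} (-‿involutive (X ^ suc j))) ⟨
    (1# - - (X ^ suc j)) * v j    ≈⟨ *-congʳ (+-congˡ {1#} (-‿cong ([-x]^1+even X 2∣j))) ⟨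
    (1# - x ^ suc j) * v j        ≈⟨ *-comm (1# - x ^ suc j) (v j) ⟩
    v j * (1# - x ^ suc j)        ≈⟨ v-inverse j ⟩
    1#                            ∎
    where
    r : ℤ⟦q⟧
    r = ι (ratio (suc j))

  -- The number of colours is c = t + 1, so that c ∸ 1 = t, and c + 1 = kp in the theorem.
  factor*-constant : ∀ {p t} → p ∣ suc (suc t) → ∀ j →
    ConstantMod p (ι (factor (suc t) (suc j)) * ((1# + x ^ suc j) * v j))
  factor*-constant {p} {t} p∣c j = by-parity (2 ∣? suc j)
    where
    r g : ℤ⟦q⟧
    r = ι (ratio (suc j))
    g = (1# + x ^ suc j) * v j
    by-parity : Dec (2 ∣ suc j) → ConstantMod p (ι (factor (suc t) (suc j)) * g)
    by-parity (no 2∤1+j) = constant-≈ (begin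
      1#                              ≈⟨ ratio-inverse-odd (2∤1+n⇒2∣n 2∤1+j) ⟨
      r * g                           ≡⟨ cong (λ f → ι f * g) (factor-odd (suc t) 2∤1+j) ⟨
      ι (factor (suc t) (suc j)) * g  ∎) (constant-1 p)
    -- The t + 1 colours contribute t + 1 copies of `r`, and the factor of `P` is one more, so the
    -- total exponent t + 2 is a multiple of p.
    by-parity (yes 2∣1+j) = constant-≈ (begin
      r ^ suc (suc t)                                ≈⟨ *-comm r (r ^ suc t) ⟩
      r * r ^ t * r                                  ≈⟨ *-congˡ {r * r ^ t} (ratio≈-even 2∣1+j) ⟩
      r * r ^ t * g                                  ≈⟨ *-congʳ (*-congˡ {r} (ι-pow (ratio (suc j)) t)) ⟨
      r * ι (pow (ratio (suc j)) t) * g              ≈⟨ *-congʳ (ι-⊛ (ratio (suc j)) (pow (ratio (suc j)) t)) ⟨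
      ι (ratio (suc j) ⊛ pow (ratio (suc j)) t) * g  ≡⟨ cong (λ f → ι f * g) (factor-even (suc t) 2∣1+j) ⟨
      ι (factor (suc t) (suc j)) * g                 ∎) (constant-^ r p∣c)

  -- This product is a truncation of H. Pairing each factor of the generating function with the
  -- factor of `P` of the same index reduces the claim to single factors.
  prodUpTo*P-constant : ∀ {p t} → p ∣ suc (suc t) → ∀ N → ConstantMod p (ι (prodUpTo (suc t) N) * P N)
  prodUpTo*P-constant {p} p∣c zero = constant-≈ (sym (trans (*-identityʳ (ι one)) ι-one)) (constant-1 p)
  prodUpTo*P-constant {p} {t} p∣c (suc N) = constant-≈ (sym (trans
      (*-congʳ (ι-⊛ (factor (suc t) (suc N)) (prodUpTo (suc t) N)))
      (*-interchange (ι (factor (suc t) (suc N))) (ι (prodUpTo (suc t) N)) (P N) ((1# + x ^ suc N) * v N))))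
    (constant-* (factor*-constant p∣c N) (prodUpTo*P-constant p∣c N))

  -- Multiplying by `S N * P N`, which is 1 up to a multiple of x^(N+1), leaves the coefficient at N
  -- unchanged.
  coefficient-prodUpTo : ∀ c N → + prodUpTo c N N ≡ (S N * (ι (prodUpTo c N) * P N)) N
  coefficient-prodUpTo c N with e , SP≈ ← S*P≈1+x^* N = ≡.sym (≡.trans (at S*[A*P]≈ N)
    (≡.trans (cong (λ t → A N ℤ.+ t)
                   (x^∗-≡0 (suc N) (e * A) {N} (X^∗-< {suc N} {N} (e * A) ℕ.≤-refl))) (ℤ.+-identityʳ (A N))))
    where
    A : ℤ⟦q⟧
    A = ι (prodUpTo c N)
    S*[A*P]≈ : S N * (A * P N) ≈ A + x ^ suc N * (e * A)
    S*[A*P]≈ = begin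
      S N * (A * P N)               ≈⟨ *-congˡ {S N} (*-comm A (P N)) ⟩
      S N * (P N * A)               ≈⟨ *-assoc (S N) (P N) A ⟨
      S N * P N * A                 ≈⟨ *-congʳ SP≈ ⟩
      (1# + x ^ suc N * e) * A      ≈⟨ distribʳ A 1# (x ^ suc N * e) ⟩
      1# * A + x ^ suc N * e * A    ≈⟨ +-cong (*-identityˡ A) (*-assoc (x ^ suc N) e A) ⟩
      A + x ^ suc N * (e * A)       ∎

  -- Series supported on the squares.

  SquareSupported : ℤ⟦q⟧ → Set
  SquareSupported f = ∀ n → (∃ λ s → s ℕ.* s ≡ n) ⊎ f n ≡ + 0

  supported-+ : ∀ {f g} → SquareSupported f → SquareSupported g → SquareSupported (f + g)
  supported-+ f-supp g-supp n with f-supp n | g-supp n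
  ... | inj₁ sq | _       = inj₁ sq
  ... | inj₂ _  | inj₁ sq = inj₁ sq
  ... | inj₂ f0 | inj₂ g0 = inj₂ (cong₂ ℤ._+_ f0 g0)

  supported-neg : ∀ {f} → SquareSupported f → SquareSupported (- f)
  supported-neg f-supp n with f-supp n
  ... | inj₁ sq = inj₁ sq
  ... | inj₂ f0 = inj₂ (cong ℤ.-_ f0)

  supported-≈ : ∀ {f g} → f ≈ g → SquareSupported f → SquareSupported g
  supported-≈ f≈g f-supp n with f-supp n
  ... | inj₁ sq = inj₁ sq
  ... | inj₂ f0 = inj₂ (≡.trans (≡.sym (at f≈g n)) f0)

  supported-1 : SquareSupported 1#
  supported-1 zero    = inj₁ (0 , ≡.refl)
  supported-1 (suc _) = inj₂ ≡.refl

  supported-x^n^n : ∀ n → SquareSupported ((x ^ n) ^ n)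
  supported-x^n^n n = supported-≈ (sym (^-assocʳ x n n)) x^n*n-supp
    where
    x^n*n-supp : SquareSupported (x ^ (n ℕ.* n))
    x^n*n-supp i with i ≟ n ℕ.* n
    ... | yes ≡.refl = inj₁ (n , ≡.refl)
    ... | no i≢n*n   = inj₂ (≡.trans (≡.sym (at (*-identityʳ (x ^ (n ℕ.* n))) i))
      (x^∗-≡0 (n ℕ.* n) 1# {i} (≡.trans (at (*-identityʳ (X ^ (n ℕ.* n))) i) (X^-off-diagonal i≢n*n))))

  -- As δ s is 2 or -2, closure under sums and negation suffices.
  supported-δ* : ∀ s {f} → SquareSupported f → SquareSupported (δ s * f)
  supported-δ* zero {f} f-supp = supported-≈
    (sym (trans (distribʳ f 1# 1#) (+-cong (*-identityˡ f) (*-identityˡ f)))) (supported-+ f-supp f-supp)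
  supported-δ* (suc s) {f} f-supp = supported-≈ (-‿distribˡ-* (δ s) f) (supported-neg (supported-δ* s f-supp))

  supported-S : ∀ n → SquareSupported (S n)
  supported-S zero    = supported-1
  supported-S (suc n) = supported-+ (supported-S n) (supported-δ* (suc n) (supported-x^n^n (suc n)))

  -- Divisibility of the coefficients at pn + r.

  p∣abar : ∀ {p r t} → Prime p → 1 ≤ p → QNR p r → p ∣ suc (suc t) → ∀ n → p ∣ abar (suc t) (p ℕ.* n ℕ.+ r)
  p∣abar {p} {r} {t} p-prime 1≤p qnr p∣c n = ℤ∣.∣⇒∣ᵤ
    (≡.subst (+ p ℤ∣.∣_) (≡.sym (coefficient-prodUpTo (suc t) N)) (∣-coefficient-∗ (S N) H N p∣term))
    where
    N : ℕ
    N = p ℕ.* n ℕ.+ r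
    H : ℤ⟦q⟧
    H = ι (prodUpTo (suc t) N) * P N
    p∣term : ∀ i j → i ℕ.+ j ≡ N → + p ℤ∣.∣ S N i ℤ.* H j
    -- At a square index i = s² the other factor `H j` is divisible by p, because j = N - s² is
    -- prime to p; at any other index `S N i` vanishes.
    p∣term i j i+j≡N with supported-S N i
    ... | inj₁ (s , ≡.refl) = ℤ∣.∣n⇒∣m*n (S N i)
            (constantMod⇒∣coefficient p-prime (prodUpTo*P-constant p∣c N) (QNR⇒p∤ n s j qnr i+j≡N 1≤p))
    ... | inj₂ S≡0 = ℤ∣.∣m⇒∣m*n (H j) (≡.subst (+ p ℤ∣.∣_) (≡.sym S≡0) (ℤ∣.divides (+ 0) ≡.refl))

open GeneratingFunctions using (p∣abar)
open import Data.Nat using (_+_; _*_)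

theorem4p1 : (p r k : ℕ) → Prime p → 3 ≤ p → 1 ≤ r → r ≤ p ∸ 1 → QNR p r → 1 ≤ k →
    (n : ℕ) → p ∣ abar (k * p ∸ 1) (p * n + r)
theorem4p1 p r k p-prime 3≤p _ _ qnr 1≤k n
  with k * p | ℕ.*-mono-≤ 1≤k 3≤p | divides {p} k ≡.refl
-- From k ≥ 1 and p ≥ 3 the product kp is at least 3, so it has the form t + 2 and `k * p ∸ 1` is t
-- + 1 without truncation.
... | suc (suc t) | s≤s (s≤s _) | p∣kp = p∣abar p-prime (ℕ.≤-trans (s≤s z≤n) 3≤p) qnr p∣kp n
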